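{- Let $n$ and $\ell$ be positive integers, let $D$ be a condition on families of subsets of $[n]$, and let $\mathcal{F}\subset 2^{[n]}$ be a family satisfying $D$. Then $\mathcal{F}$ contains at most $S_\ell(n,D)$ $\ell$-chains, i.e. the number of $\ell$-chains $\mathcal{G}_\ell$ with $\mathcal{G}_\ell\subset\mathcal{F}$ is at most $S_\ell(n,D)$.
   Context: $[n]=\{1,2,\dots,n\}$ and $2^{[n]}$ is the family of all subsets of $[n]$. A condition $D$ is an arbitrary property (predicate) that a family $\mathcal{F}\subset 2^{[n]}$ may or may not satisfy. A full chain is a family $\mathcal{C}=\{A_0,A_1,\dots,A_n\}$ of sets $A_i\in 2^{[n]}$ with $|A_i|=i$ for all $i$ and $A_i\subset A_{i+1}$ for every $0\le i<n$. Let $\mathfrak{C}_n$ denote the set of all $n!$ full chains in $2^{[n]}$. An $\ell$-chain is a family $\mathcal{G}_\ell=\{G_1,\dots,G_\ell\}$ of $\ell$ distinct subsets of $[n]$ with $G_1\subset G_2\subset\dots\subset G_\ell$. For a family $\mathcal{F}\subset 2^{[n]}$ and an $\ell$-chain $\mathcal{G}_\ell=\{G_1\subset\dots\subset G_\ell\}\subset 2^{[n]}$, let $$\omega_{\mathcal{F}}(\mathcal{G}_\ell)=\binom{n}{|G_\ell|}\binom{|G_\ell|}{|G_{\ell-1}|}\cdots\binom{|G_2|}{|G_1|}$$ if $\mathcal{G}_\ell\subset\mathcal{F}$, and $\omega_{\mathcal{F}}(\mathcal{G}_\ell)=0$ otherwise. Define $$s_\ell(\mathcal{F})=\max_{\mathcal{C}\in\mathfrak{C}_n}\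 \sum_{\mathcal{G}_\ell\subset\mathcal{C}}\omega_{\mathcal{F}}(\mathcal{G}_\ell),$$ where the sum is over all $\ell$-chains $\mathcal{G}_\ell$ contained in $\mathcal{C}$, and $$S_\ell(n,D)=\max\{s_\ell(\mathcal{F}') : \mathcal{F}'\subset 2^{[n]},\ \mathcal{F}'\text{ satisfies } D\}.$$ -}

module Defs where

open import Data.Bool.Base using (Bool; true; T; if_then_else_)
open import Data.Bool.Properties using (T?)
import Data.Bool.Properties as Bool
open import Data.Fin.Base using (toℕ)
import Data.Fin.Properties as Fin
open import Data.Fin.Subset using (Subset; ∣_∣; _⊂_; inside; outside)
open import Data.Fin.Subset.Properties using (_⊂?_)
open import Data.List.Base
  using (List; []; _∷_; map; filter; length; cartesianProductWith)
open import Data.List.Extrema.Nat using (max; max≤v⁺; v≤max⁺)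
open import Data.List.Membership.Propositional using (_∈_)
open import Data.List.Membership.Propositional.Properties
  using (∈-cartesianProductWith⁺)
open import Data.List.Relation.Unary.All as ListAll using ([]; _∷_)
import Data.List.Relation.Unary.All.Properties as ListAll
open import Data.List.Relation.Unary.Any as ListAny using (here; there)
import Data.List.Relation.Unary.Any.Properties as ListAny
open import Data.List.Relation.Unary.Unique.Propositional using (Unique; []; _∷_)
import Data.List.Relation.Unary.Unique.Propositional.Properties as Unique
open import Data.Nat.Base using (ℕ; zero; suc; _+_; _*_; _≤_; z≤n)
open import Data.Nat.Combinatorics using (_C_)
open import Data.Nat.ListAction using (sum)
import Data.Nat.Properties as ℕ
open import Data.Product.Base using (∃; _×_; _,_)
open import Data.Sum.Base using (inj₂)
open import Data.Vec.Base as Vec using (Vec; []; _∷_; lookup)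
import Data.Vec.Membership.DecPropositional as DecMembership
open import Data.Vec.Membership.Propositional using () renaming (_∈_ to _∈ᵛ_)
open import Data.Vec.Properties using (∷-injective; ≡-dec)
open import Data.Vec.Relation.Unary.All as All using (All)
open import Data.Vec.Relation.Unary.Linked using (Linked; linked?)
open import Level using (Level; 0ℓ)
open import Relation.Binary.PropositionalEquality.Core using (_≡_; refl; subst)
open import Relation.Nullary.Decidable.Core using (Dec; does; yes; no; _×-dec_)
open import Relation.Nullary.Negation.Core using (¬_; contradiction)
open import Relation.Unary using (Pred; Decidable)

private
  variable
    a p : Level
    A : Set a
    n ℓ : ℕ

-- A family of subsets of [n] is given by its characteristic function.  A condition
-- is any predicate on Family n; it is not required to respect pointwise equality.
Family : ℕ → Set
Family n = Subset n → Bool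

infix 4 _∈ᶠ_ _⊆ᶠ_ _⊆ᵛ_ _⊆ᶠ?_ _⊆ᵛ?_

_∈ᶠ_ : Subset n → Family n → Set
A ∈ᶠ F = T (F A)

-- A chain {G₁ ⊂ … ⊂ G_ℓ} is encoded by the vector G₁ ∷ … ∷ G_ℓ ∷ [] listing its
-- members in increasing order.  _⊂_ is strict inclusion, so the members are
-- distinct, and each ℓ-chain has exactly one such listing.
IsChain : Pred (Vec (Subset n) ℓ) 0ℓ
IsChain = Linked _⊂_

isChain? : Decidable (IsChain {n} {ℓ})
isChain? = linked? _⊂?_

IsFullChain : Pred (Vec (Subset n) (suc n)) 0ℓ
IsFullChain 𝒞 = (∀ i → ∣ lookup 𝒞 i ∣ ≡ toℕ i) × IsChain 𝒞

isFullChain? : Decidable (IsFullChain {n})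
isFullChain? 𝒞 =
  Fin.all? (λ i → ∣ lookup 𝒞 i ∣ ℕ.≟ toℕ i) ×-dec isChain? 𝒞

_⊆ᶠ_ : Vec (Subset n) ℓ → Family n → Set
G ⊆ᶠ F = All (_∈ᶠ F) G

_⊆ᶠ?_ : (G : Vec (Subset n) ℓ) (F : Family n) → Dec (G ⊆ᶠ F)
G ⊆ᶠ? F = All.all? (λ A → T? (F A)) G

_⊆ᵛ_ : ∀ {k} → Vec (Subset n) ℓ → Vec (Subset n) k → Set
G ⊆ᵛ 𝒞 = All (_∈ᵛ 𝒞) G

_⊆ᵛ?_ : ∀ {k} (G : Vec (Subset n) ℓ) (𝒞 : Vec (Subset n) k) → Dec (G ⊆ᵛ 𝒞)
G ⊆ᵛ? 𝒞 = All.all? (_∈? 𝒞) G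
  where open DecMembership (≡-dec Bool._≟_) using (_∈?_)

-- All vectors of length k with entries from xs; by ∈-vecs and vecs-unique below,
-- each occurs exactly once if xs lists every element of A exactly once.
vecs : List A → (k : ℕ) → List (Vec A k)
vecs xs zero    = [] ∷ []
vecs xs (suc k) = cartesianProductWith _∷_ xs (vecs xs k)

subsets : (n : ℕ) → List (Subset n)
subsets = vecs (outside ∷ inside ∷ [])

chains : (n ℓ : ℕ) → List (Vec (Subset n) ℓ)
chains n ℓ = filter isChain? (vecs (subsets n) ℓ)

fullChains : (n : ℕ) → List (Vec (Subset n) (suc n))
fullChains n = filter isFullChain? (vecs (subsets n) (suc n))

#chains : (ℓ : ℕ) → Family n → ℕ
#chains ℓ F = length (filter (_⊆ᶠ? F) (chains _ ℓ))

-- The product of binomials (n choose |G_ℓ|) (|G_ℓ| choose |G_{ℓ-1}|) ⋯ (|G₂| choose |G₁|).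
weight : Vec (Subset n) ℓ → ℕ
weight         []            = 1
weight {n = n} (G ∷ [])      = n C ∣ G ∣
weight         (G ∷ G′ ∷ Gs) = weight (G′ ∷ Gs) * (∣ G′ ∣ C ∣ G ∣)

ω : Family n → Vec (Subset n) ℓ → ℕ
ω F G = if does (G ⊆ᶠ? F) then weight G else 0

-- The default value 0 of max is harmless: there is always a full chain.
s : (ℓ : ℕ) → Family n → ℕ
s {n} ℓ F =
  max 0 (map (λ 𝒞 → sum (map (ω F) (filter (_⊆ᵛ? 𝒞) (chains n ℓ)))) (fullChains n))

IsMaximum : Pred ℕ p → Pred ℕ p
IsMaximum P m = P m × (∀ k → P k → k ≤ m)

-- IsS ℓ n D m says that S_ℓ(n,D) = m.  It is a relation because the maximum of s
-- over an arbitrary, possibly undecidable, condition D cannot be computed; that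
-- m is determined by D and that it (classically) exists are IsS-unique and
-- IsS-exists below.
IsS : (ℓ n : ℕ) → Pred (Family n) p → Pred ℕ p
IsS ℓ n D = IsMaximum (λ k → ∃ λ (F′ : Family n) → D F′ × s ℓ F′ ≡ k)

∈-vecs : {xs : List A} → (∀ x → x ∈ xs) → ∀ {k} (v : Vec A k) → v ∈ vecs xs k
∈-vecs all []      = here refl
∈-vecs all (x ∷ v) = ∈-cartesianProductWith⁺ _∷_ (all x) (∈-vecs all v)

vecs-unique : {xs : List A} → Unique xs → ∀ k → Unique (vecs xs k)
vecs-unique xs! zero    = [] ∷ []
vecs-unique xs! (suc k) =
  Unique.cartesianProductWith⁺ _∷_ ∷-injective xs! (vecs-unique xs! k)

∈-subsets : (A : Subset n) → A ∈ subsets n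
∈-subsets = ∈-vecs λ where
  outside → here refl
  inside  → there (here refl)

subsets-unique : ∀ n → Unique (subsets n)
subsets-unique = vecs-unique (((λ ()) ∷ []) ∷ [] ∷ [])

IsS-unique : {D : Pred (Family n) p} {m m′ : ℕ} → IsS ℓ n D m → IsS ℓ n D m′ → m ≡ m′
IsS-unique (Pm , m-ub) (Pm′ , m′-ub) = ℕ.≤-antisym (m′-ub _ Pm) (m-ub _ Pm′)

private
  maximum-exists : {P : Pred ℕ p} → ∃ P → ∀ b → (∀ k → P k → k ≤ b) → ¬ ¬ ∃ (IsMaximum P)
  maximum-exists {P = P} (x , Px) zero ub ¬max =
    ¬max (0 , subst P (ℕ.n≤0⇒n≡0 (ub x Px)) Px , ub)
  maximum-exists {P = P} ∃P (suc b) ub ¬max = maximum-exists ∃P b ub′ ¬max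
    where
    ub′ : ∀ k → P k → k ≤ b
    ub′ k Pk with k ℕ.≟ suc b
    ... | yes refl  = contradiction (suc b , Pk , ub) ¬max
    ... | no  k≢1+b = ℕ.≤-pred (ℕ.≤∧≢⇒< (ub k Pk) k≢1+b)

  sum-map-mono : {f g : A → ℕ} → (∀ x → f x ≤ g x) → ∀ xs → sum (map f xs) ≤ sum (map g xs)
  sum-map-mono f≤g []       = z≤n
  sum-map-mono f≤g (x ∷ xs) = ℕ.+-mono-≤ (f≤g x) (sum-map-mono f≤g xs)

  max-map-mono : {f g : A → ℕ} → (∀ x → f x ≤ g x) → ∀ xs → max 0 (map f xs) ≤ max 0 (map g xs)
  max-map-mono {g = g} f≤g xs = max≤v⁺ {xs = map _ xs} z≤n (ListAll.map⁺ (ListAll.tabulate λ {x} x∈xs →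
    v≤max⁺ 0 (map g xs) (inj₂ (ListAny.map⁺ (ListAny.map (λ { refl → f≤g x }) x∈xs)))))

  ω≤weight : (F : Family n) (G : Vec (Subset n) ℓ) → ω F G ≤ ω (λ _ → true) G
  ω≤weight F G with G ⊆ᶠ? F | G ⊆ᶠ? (λ _ → true)
  ... | no  _   | _      = z≤n
  ... | yes _   | yes _  = ℕ.≤-refl
  ... | yes _   | no  ¬⊤ = contradiction (All.universal (λ _ → _) G) ¬⊤

IsS-exists : {D : Pred (Family n) p} → ∃ D → ¬ ¬ ∃ (IsS ℓ n D)
IsS-exists {n = n} {ℓ = ℓ} (F , DF) =
  maximum-exists (s ℓ F , F , DF , refl) (s {n} ℓ (λ _ → true)) λ where
    _ (F′ , _ , refl) → max-map-mono
      (λ 𝒞 → sum-map-mono (ω≤weight F′) (filter (_⊆ᵛ? 𝒞) (chains n ℓ))) (fullChains n)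

{-# OPTIONS --safe #-}

-- Double counting of the pairs (𝒢, 𝒞), where 𝒢 is an ℓ-chain in F and 𝒞 ⊇ 𝒢 is a
-- full chain.  An ℓ-chain G₁ ⊂ … ⊂ G_ℓ lies on |G₁|! (|G₂| − |G₁|)! ⋯ (n − |G_ℓ|)!
-- of the n! full chains, and its weight is n! divided by that number.  Hence
-- the sums Σ_{𝒢 ⊂ 𝒞} ω_F(𝒢), added up over all full chains 𝒞, give n! times the
-- number of ℓ-chains in F, and some full chain attains at least the average.

module Submission where

open import Defs
open import Data.Bool.Base using (if_then_else_; true; false)
open import Data.Fin.Base using (toℕ; zero; suc)
open import Data.Fin.Subset using (Subset; ∣_∣; _⊆_; _⊂_; ⊤; ⊥; inside; outside)
open import Data.Fin.Subset.Properties
open import Data.List.Base using (List; []; _∷_; _++_; map; filter; length; concatMap)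
open import Data.List.Extrema.Nat using (xs≤max)
open import Data.List.Membership.Propositional using (_∈_)
open import Data.List.Membership.Propositional.Properties using (∈-filter⁺)
open import Data.List.Properties using (map-cong; map-cong-local; map-∘; map-++)
open import Data.List.Relation.Unary.All as ListAll using ([]; _∷_)
import Data.List.Relation.Unary.All.Properties as ListAll
open import Data.Nat.Base using (ℕ; zero; suc; NonZero; _+_; _*_; _∸_; _≤_; z≤n; _!)
open import Data.Nat.Combinatorics using (_C_; nCk≡n!/k![n-k]!; k![n∸k]!∣n!)
open import Data.Nat.DivMod using (m/n*n≡m)
open import Data.Nat.ListAction using (sum)
open import Data.Nat.ListAction.Properties using (sum-++)
open import Data.Nat.Properties
open import Data.Nat.Solver using (module +-*-Solver)
open import Data.Product.Base using (_×_; _,_)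
open import Data.Sum.Base as Sum using (_⊎_; inj₁; inj₂)
open import Data.Vec.Base as Vec using (Vec; []; _∷_; lookup)
open import Data.Vec.Membership.Propositional using () renaming (_∈_ to _∈ᵛ_)
open import Data.Vec.Relation.Unary.All as All using (All; []; _∷_)
open import Data.Vec.Relation.Unary.Any using (here; there)
open import Data.Vec.Relation.Unary.Linked as Linked using ([]; [-]; _∷_)
open import Data.Vec.Relation.Unary.Linked.Properties using (Linked⇒All)
open import Function.Base using (_∘_)
open import Function.Bundles using (_⇔_; mk⇔)
open import Level using (Level)
open import Relation.Binary.PropositionalEquality
open import Relation.Nullary.Decidable using (Dec; does; yes; no; dec-true; dec-false; does-⇔)
open import Relation.Nullary.Negation using (¬_; contradiction)
open import Relation.Unary using (Pred; Decidable)
open +-*-Solver using (solve; _:+_; _:*_; _:=_)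

private
  variable
    a p : Level
    X Y P Q : Set a
    n ℓ : ℕ

-- Finite sums and indicators

χ : Dec P → ℕ
χ P? = if does P? then 1 else 0

χ-true : (P? : Dec P) → P → χ P? ≡ 1
χ-true P? p = cong (if_then 1 else 0) (dec-true P? p)

χ-false : (P? : Dec P) → ¬ P → χ P? ≡ 0
χ-false P? ¬p = cong (if_then 1 else 0) (dec-false P? ¬p)

χ-cong : P ⇔ Q → (P? : Dec P) (Q? : Dec Q) → χ P? ≡ χ Q?
χ-cong P⇔Q P? Q? = cong (if_then 1 else 0) (does-⇔ P⇔Q P? Q?)

∑ : List X → (X → ℕ) → ℕ
∑ xs f = sum (map f xs)

infix 5 ∑
syntax ∑ xs (λ x → e) = ∑[ x ← xs ] e

∑-cong : {f g : X → ℕ} → (∀ x → f x ≡ g x) → ∀ xs → ∑ xs f ≡ ∑ xs g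
∑-cong f≗g xs = cong sum (map-cong f≗g xs)

∑-cong-local : {f g : X → ℕ} {xs : List X} → ListAll.All (λ x → f x ≡ g x) xs → ∑ xs f ≡ ∑ xs g
∑-cong-local = cong sum ∘ map-cong-local

∑-zero : (xs : List X) → ∑ xs (λ _ → 0) ≡ 0
∑-zero []       = refl
∑-zero (_ ∷ xs) = ∑-zero xs

∑-map : (f : X → ℕ) (g : Y → X) (ys : List Y) → ∑ (map g ys) f ≡ ∑ ys (f ∘ g)
∑-map f g ys = cong sum (sym (map-∘ ys))

∑-concatMap : (f : X → ℕ) (g : Y → List X) (ys : List Y) →
              ∑ (concatMap g ys) f ≡ ∑[ y ← ys ] ∑ (g y) f
∑-concatMap f g []       = refl
∑-concatMap f g (y ∷ ys) = begin
  sum (map f (g y ++ concatMap g ys))         ≡⟨ cong sum (map-++ f (g y) _) ⟩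
  sum (map f (g y) ++ map f (concatMap g ys)) ≡⟨ sum-++ (map f (g y)) _ ⟩
  ∑ (g y) f + ∑ (concatMap g ys) f            ≡⟨ cong (∑ (g y) f +_) (∑-concatMap f g ys) ⟩
  ∑ (g y) f + (∑[ z ← ys ] ∑ (g z) f)         ∎
  where open ≡-Reasoning

∑-*ˡ : ∀ c (f : X → ℕ) xs → ∑[ x ← xs ] (c * f x) ≡ c * ∑ xs f
∑-*ˡ c f []       = sym (*-zeroʳ c)
∑-*ˡ c f (x ∷ xs) = trans (cong (c * f x +_) (∑-*ˡ c f xs)) (sym (*-distribˡ-+ c (f x) _))

∑-*ʳ : ∀ c (f : X → ℕ) xs → ∑[ x ← xs ] (f x * c) ≡ ∑ xs f * c
∑-*ʳ c f []       = refl
∑-*ʳ c f (x ∷ xs) = trans (cong (f x * c +_) (∑-*ʳ c f xs)) (sym (*-distribʳ-+ c (f x) _))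

∑-+ : (f g : X → ℕ) (xs : List X) → ∑[ x ← xs ] (f x + g x) ≡ ∑ xs f + ∑ xs g
∑-+ f g []       = refl
∑-+ f g (x ∷ xs) = trans (cong (f x + g x +_) (∑-+ f g xs)) (+-interchange (f x) (g x) _ _)
  where
  +-interchange : ∀ i j k l → i + j + (k + l) ≡ i + k + (j + l)
  +-interchange = solve 4 (λ i j k l → i :+ j :+ (k :+ l) := i :+ k :+ (j :+ l)) refl

∑-swap : (f : X → Y → ℕ) (xs : List X) (ys : List Y) →
         ∑[ x ← xs ] ∑[ y ← ys ] f x y ≡ ∑[ y ← ys ] ∑[ x ← xs ] f x y
∑-swap f []       ys = sym (∑-zero ys)
∑-swap f (x ∷ xs) ys =
  trans (cong (∑ ys (f x) +_) (∑-swap f xs ys)) (sym (∑-+ (f x) _ ys))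

∑-filter : {P : Pred X p} (P? : Decidable P) (f : X → ℕ) (xs : List X) →
           ∑ (filter P? xs) f ≡ ∑[ x ← xs ] (f x * χ (P? x))
∑-filter P? f []       = refl
∑-filter P? f (x ∷ xs) with does (P? x)
... | true  = cong₂ _+_ (sym (*-identityʳ (f x))) (∑-filter P? f xs)
... | false = cong₂ _+_ (sym (*-zeroʳ (f x))) (∑-filter P? f xs)

length-filter-χ : {P : Pred X p} (P? : Decidable P) (xs : List X) →
                  length (filter P? xs) ≡ ∑[ x ← xs ] χ (P? x)
length-filter-χ P? []       = refl
length-filter-χ P? (x ∷ xs) with does (P? x)
... | true  = cong suc (length-filter-χ P? xs)
... | false = length-filter-χ P? xs

-- The length of `xs` is written as a sum of ones because `#through k A []` computes to that form:
-- the empty chain lies on every chain.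
∑-bound : ∀ {M} {f : X → ℕ} {xs} → ListAll.All (λ x → f x ≤ M) xs → ∑ xs f ≤ ∑ xs (λ _ → 1) * M
∑-bound         []           = z≤n
∑-bound {M = M} (f≤M ∷ fs≤M) = +-mono-≤ f≤M (∑-bound fs≤M)

-- The quotient formula for binomials, cleared of its division. The complement enters as a `d` with
-- `k + d ≡ n`, which matches the gap between two consecutive chain members.
nCk*k!*d!≡n! : ∀ k d → k + d ≡ n → (n C k) * k ! * d ! ≡ n !
nCk*k!*d!≡n! {n} k d refl = begin
  (n C k) * k ! * d !         ≡⟨ *-assoc (n C k) (k !) (d !) ⟩
  (n C k) * (k ! * d !)       ≡⟨ cong (λ e → (n C k) * (k ! * e !)) (sym (m+n∸m≡n k d)) ⟩
  (n C k) * (k ! * (n ∸ k) !) ≡⟨ cong (_* (k ! * (n ∸ k) !)) (nCk≡n!/k![n-k]! k≤n) ⟩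
  _                           ≡⟨ m/n*n≡m {{k !* (n ∸ k) !≢0}} (k![n∸k]!∣n! k≤n) ⟩
  n !                         ∎
  where
  open ≡-Reasoning
  k≤n : k ≤ k + d
  k≤n = m≤m+n k d

-- Carries an invariant such as `∣ A ∣ + k ≡ n` over to a cover of `A`, where the remaining climb is
-- one shorter.
suc-shift : ∀ {i j k m} → j ≡ suc i → i + suc k ≡ m → j + k ≡ m
suc-shift {i} {k = k} refl i+1+k = trans (sym (+-suc i k)) i+1+k

-- Covers in the subset lattice and saturated chains

⊆⇒≡⊎⊂ : (A B : Subset n) → A ⊆ B → A ≡ B ⊎ A ⊂ B
⊆⇒≡⊎⊂ []            []            _   = inj₁ refl
⊆⇒≡⊎⊂ (inside  ∷ A) (outside ∷ B) A⊆B with () ← A⊆B Vec.here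
⊆⇒≡⊎⊂ (inside  ∷ A) (inside  ∷ B) A⊆B =
  Sum.map (cong (inside ∷_)) in⊂in (⊆⇒≡⊎⊂ A B (drop-∷-⊆ A⊆B))
⊆⇒≡⊎⊂ (outside ∷ A) (outside ∷ B) A⊆B =
  Sum.map (cong (outside ∷_)) out⊂ (⊆⇒≡⊎⊂ A B (drop-∷-⊆ A⊆B))
⊆⇒≡⊎⊂ (outside ∷ A) (inside  ∷ B) A⊆B = inj₂ (out⊂in (drop-∷-⊆ A⊆B))

covers : Subset n → List (Subset n)
covers []            = []
covers (inside  ∷ A) = map (inside ∷_) (covers A)
covers (outside ∷ A) = (inside ∷ A) ∷ map (outside ∷_) (covers A)

covers-size : (A : Subset n) → ListAll.All (λ B → ∣ B ∣ ≡ suc ∣ A ∣) (covers A)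
covers-size []            = []
covers-size (inside  ∷ A) = ListAll.map⁺ (ListAll.map (cong suc) (covers-size A))
covers-size (outside ∷ A) = refl ∷ ListAll.map⁺ (covers-size A)

covers-⊂ : (A : Subset n) → ListAll.All (A ⊂_) (covers A)
covers-⊂ []            = []
covers-⊂ (inside  ∷ A) = ListAll.map⁺ (ListAll.map in⊂in (covers-⊂ A))
covers-⊂ (outside ∷ A) = out⊂in ⊆-refl ∷ ListAll.map⁺ (ListAll.map out⊂ (covers-⊂ A))

-- A cover of `A` inside `B` adds one element of `B` outside `A`. The additive form avoids truncated
-- subtraction.
covers-count : (A B : Subset n) → A ⊆ B → ∣ A ∣ + (∑[ A′ ← covers A ] χ (A′ ⊆? B)) ≡ ∣ B ∣
covers-count []            []            _   = refl
covers-count (inside  ∷ A) (outside ∷ B) A⊆B with () ← A⊆B Vec.here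
covers-count (inside  ∷ A) (inside  ∷ B) A⊆B =
  cong suc (trans (cong (∣ A ∣ +_) (∑-map _ (inside ∷_) (covers A)))
                  (covers-count A B (drop-∷-⊆ A⊆B)))
covers-count (outside ∷ A) (outside ∷ B) A⊆B =
  trans (cong (∣ A ∣ +_) (∑-map _ (outside ∷_) (covers A)))
        (covers-count A B (drop-∷-⊆ A⊆B))
covers-count (outside ∷ A) (inside  ∷ B) A⊆B = begin
  ∣ A ∣ + (χ (A ⊆? B) + _) ≡⟨ cong₂ (λ i j → ∣ A ∣ + (i + j)) (χ-true (A ⊆? B) (drop-∷-⊆ A⊆B))
                                (∑-map _ (outside ∷_) (covers A)) ⟩
  ∣ A ∣ + suc _            ≡⟨ +-suc ∣ A ∣ _ ⟩
  suc (∣ A ∣ + _)          ≡⟨ cong suc (covers-count A B (drop-∷-⊆ A⊆B)) ⟩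
  suc ∣ B ∣                ∎
  where open ≡-Reasoning

-- The source of every factorial factor: a climb from `A` towards `B` has `d` possible first steps,
-- each worth the same `c`, while steps that leave `B` are worth 0.
∑-covers : ∀ {c d} {A B : Subset n} {h : Subset n → ℕ} → A ⊆ B → ∣ A ∣ + d ≡ ∣ B ∣ →
           (∀ A′ → ∣ A′ ∣ ≡ suc ∣ A ∣ → h A′ ≡ χ (A′ ⊆? B) * c) → ∑ (covers A) h ≡ d * c
∑-covers {c = c} {d} {A} {B} {h} A⊆B A+d h-eq = begin
  ∑ (covers A) h                           ≡⟨ ∑-cong-local (ListAll.map (h-eq _) (covers-size A)) ⟩
  ∑[ A′ ← covers A ] (χ (A′ ⊆? B) * c)     ≡⟨ ∑-*ʳ c _ (covers A) ⟩
  (∑[ A′ ← covers A ] χ (A′ ⊆? B)) * c     ≡⟨ cong (_* c) (+-cancelˡ-≡ ∣ A ∣ _ _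
                                                (trans (covers-count A B A⊆B) (sym A+d))) ⟩
  d * c                                    ∎
  where open ≡-Reasoning

-- Built recursively from covers, so that counts unfold one step at a time, unlike those over the
-- filtered list `fullChains`.
saturated : (k : ℕ) → Subset n → List (Vec (Subset n) (suc k))
saturated zero    A = (A ∷ []) ∷ []
saturated (suc k) A = concatMap (λ A′ → map (A ∷_) (saturated k A′)) (covers A)

∑-saturated : ∀ k (A : Subset n) (f : Vec (Subset n) (suc (suc k)) → ℕ) →
              ∑ (saturated (suc k) A) f ≡ ∑[ A′ ← covers A ] ∑[ 𝒞 ← saturated k A′ ] f (A ∷ 𝒞)
∑-saturated k A f = trans (∑-concatMap f _ (covers A))
  (∑-cong (λ A′ → ∑-map f (A ∷_) (saturated k A′)) (covers A))

IsSaturatedFrom : ∀ {k} → Subset n → Vec (Subset n) (suc k) → Set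
IsSaturatedFrom A 𝒞 =
  Vec.head 𝒞 ≡ A × IsChain 𝒞 × (∀ i → ∣ lookup 𝒞 i ∣ ≡ ∣ A ∣ + toℕ i)

∷-saturated : ∀ {k} {A A′ : Subset n} {𝒞 : Vec (Subset n) (suc k)} →
              ∣ A′ ∣ ≡ suc ∣ A ∣ → A ⊂ A′ → IsSaturatedFrom A′ 𝒞 → IsSaturatedFrom A (A ∷ 𝒞)
∷-saturated {A = A} ∣A′∣ A⊂A′ (refl , 𝒞-chain , sizes) = refl , A⊂A′ ∷ 𝒞-chain , λ where
  zero    → sym (+-identityʳ ∣ A ∣)
  (suc i) → trans (sizes i) (trans (cong (_+ toℕ i) ∣A′∣) (sym (+-suc ∣ A ∣ (toℕ i))))

saturated-sound : ∀ k (A : Subset n) → ListAll.All (IsSaturatedFrom A) (saturated k A)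
saturated-sound zero    A = (refl , [-] , λ where zero → sym (+-identityʳ ∣ A ∣)) ∷ []
saturated-sound (suc k) A = ListAll.concat⁺ (ListAll.map⁺ (ListAll.zipWith
  (λ {A′} (∣A′∣ , A⊂A′) →
    ListAll.map⁺ (ListAll.map (∷-saturated ∣A′∣ A⊂A′) (saturated-sound k A′)))
  (covers-size A , covers-⊂ A)))

saturated-⊆ : ∀ {k} {A : Subset n} {𝒞 : Vec (Subset n) (suc k)} → IsSaturatedFrom A 𝒞 → All (A ⊆_) 𝒞
saturated-⊆ {𝒞 = B ∷ 𝒞} (refl , 𝒞-chain , _) =
  Linked⇒All ⊆-trans ⊆-refl (Linked.map p⊂q⇒p⊆q 𝒞-chain)

-- Lets the averaging run over `saturated n ⊥`: the sum along each of its members is among those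
-- whose maximum is `s`.
saturated⊆fullChains : ListAll.All (_∈ fullChains n) (saturated n ⊥)
saturated⊆fullChains {n} = ListAll.map
  (λ {𝒞} (_ , 𝒞-chain , sizes) → ∈-filter⁺ isFullChain? (∈-vecs ∈-subsets 𝒞)
    ((λ i → trans (sizes i) (cong (_+ toℕ i) (∣⊥∣≡0 n))) , 𝒞-chain))
  (saturated-sound n ⊥)

-- Counting the saturated chains that contain a given chain

#through : (k : ℕ) → Subset n → Vec (Subset n) ℓ → ℕ
#through k A G = ∑[ 𝒞 ← saturated k A ] χ (G ⊆ᵛ? 𝒞)

-- All members of a saturated chain starting at `A` contain `A`, so `B` lies on none of these
-- chains.
#through-⊈ : ∀ k {A B : Subset n} (G : Vec (Subset n) ℓ) → ¬ A ⊆ B → #through k A (B ∷ G) ≡ 0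
#through-⊈ k {A} {B} G A⊈B = trans
  (∑-cong-local (ListAll.map
    (λ {𝒞} 𝒞-sat → χ-false (B ∷ G ⊆ᵛ? 𝒞)
      λ { (B∈𝒞 ∷ _) → A⊈B (All.lookup (saturated-⊆ 𝒞-sat) B∈𝒞) })
    (saturated-sound k A)))
  (∑-zero (saturated k A))

#through-∷ : ∀ k (A : Subset n) (G : Vec (Subset n) ℓ) → #through k A (A ∷ G) ≡ #through k A G
#through-∷ k A G = ∑-cong-local (ListAll.map
  (λ {𝒞} 𝒞-sat → χ-cong (mk⇔ All.tail (head∈ 𝒞-sat ∷_)) (A ∷ G ⊆ᵛ? 𝒞) (G ⊆ᵛ? 𝒞))
  (saturated-sound k A))
  where
  head∈ : ∀ {𝒞 : Vec _ (suc k)} → IsSaturatedFrom A 𝒞 → A ∈ᵛ 𝒞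
  head∈ {_ ∷ _} (refl , _) = here refl

-- A longer chain from `A` is `A` followed by a chain from one of its covers. The members of `G`
-- strictly contain `A`, so they must all lie in that tail.
#through-covers : ∀ k {A : Subset n} {G : Vec (Subset n) ℓ} → All (A ⊂_) G →
                  #through (suc k) A G ≡ ∑[ A′ ← covers A ] #through k A′ G
#through-covers k {A} {G} A⊂G = trans (∑-saturated k A _)
  (∑-cong (λ A′ → ∑-cong (λ 𝒞 →
    χ-cong (mk⇔ (skip A⊂G) (All.map there)) (G ⊆ᵛ? A ∷ 𝒞) (G ⊆ᵛ? 𝒞)) (saturated k A′)) (covers A))
  where
  skip : ∀ {m} {G : Vec _ m} {𝒞} → All (A ⊂_) G → G ⊆ᵛ A ∷ 𝒞 → G ⊆ᵛ 𝒞
  skip []          []                = []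
  skip (A⊂B ∷ _)   (here refl ∷ _)   = contradiction A⊂B (⊂-irref refl)
  skip (_   ∷ A⊂G) (there B∈𝒞 ∷ G⊆𝒞) = B∈𝒞 ∷ skip A⊂G G⊆𝒞

-- With `suc k` elements missing, `A` has `suc k` covers, all below `⊤`, and each has `k !`
-- continuations.
#saturated : ∀ k (A : Subset n) → ∣ A ∣ + k ≡ n → #through k A [] ≡ k !
#saturated     zero    A _   = refl
#saturated {n} (suc k) A A+k = trans (#through-covers k {A} [])
  (∑-covers {A = A} ⊆⊤ (trans A+k (sym (∣⊤∣≡n n))) λ A′ ∣A′∣ → begin
    #through k A′ []     ≡⟨ #saturated k A′ (suc-shift ∣A′∣ A+k) ⟩
    k !                  ≡⟨ *-identityˡ (k !) ⟨
    1 * k !              ≡⟨ cong (_* k !) (χ-true (A′ ⊆? ⊤) ⊆⊤) ⟨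
    χ (A′ ⊆? ⊤) * k !    ∎)
  where open ≡-Reasoning

-- The number of chains through B ∷ G is a product of factorials of the gaps; multiplying by
-- ∣ B ∣ ! supplies the gap below B, so that the binomials in weight (B ∷ G) telescope to
-- n !.  Starting at A ⊆ B leaves the factor d ! for the climb from A to B.
weight*#through-from : ∀ k {B : Subset n} {G : Vec (Subset n) ℓ} → ∣ B ∣ + k ≡ n → IsChain (B ∷ G) →
                      weight (B ∷ G) * ∣ B ∣ ! * #through k B G ≡ n !
weight*#through : ∀ k d {A B : Subset n} {G : Vec (Subset n) ℓ} →
                 ∣ A ∣ + k ≡ n → ∣ A ∣ + d ≡ ∣ B ∣ → A ⊆ B → IsChain (B ∷ G) →
                 weight (B ∷ G) * ∣ B ∣ ! * #through k A (B ∷ G) ≡ n ! * d !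

weight*#through-from {n} k {B} {[]} B+k _ =
  trans (cong ((n C ∣ B ∣) * ∣ B ∣ ! *_) (#saturated k B B+k)) (nCk*k!*d!≡n! ∣ B ∣ k B+k)
weight*#through-from {n} k {B} {B′ ∷ G} B+k (B⊂B′ ∷ G-chain) =
  -- With `d` the gap between `B` and `B′`, the factor `d !` completes `c * b !` to `∣ B′ ∣ !`,
  -- leaving the claim for the shorter chain `B′ ∷ G` seen from `B`.
  *-cancelʳ-≡ _ _ (d !) {{d !≢0}} (begin
    W * c * b ! * N * d !        ≡⟨ solve 5 (λ W c b N d →
                                      W :* c :* b :* N :* d := W :* (c :* b :* d) :* N)
                                      refl W c (b !) N (d !) ⟩
    W * (c * b ! * d !) * N      ≡⟨ cong (λ e → W * e * N) (nCk*k!*d!≡n! b d b+d) ⟩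
    W * ∣ B′ ∣ ! * N             ≡⟨ weight*#through k d B+k b+d (p⊂q⇒p⊆q B⊂B′) G-chain ⟩
    n ! * d !                    ∎)
  where
  open ≡-Reasoning
  b = ∣ B ∣
  d = ∣ B′ ∣ ∸ b
  W = weight (B′ ∷ G)
  c = ∣ B′ ∣ C b
  N = #through k B (B′ ∷ G)
  b+d : b + d ≡ ∣ B′ ∣
  b+d = m+[n∸m]≡n (<⇒≤ (p⊂q⇒∣p∣<∣q∣ B⊂B′))

-- No climb is left: equal sizes force `A ≡ B`, and the count continues from `B` itself.
weight*#through {n} k zero {A} {B} {G} A+k A+0 A⊆B G-chain with ⊆⇒≡⊎⊂ A B A⊆B
... | inj₂ A⊂B  = contradiction (trans (sym (+-identityʳ ∣ A ∣)) A+0) (<⇒≢ (p⊂q⇒∣p∣<∣q∣ A⊂B))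
... | inj₁ refl = begin
  weight (A ∷ G) * ∣ A ∣ ! * #through k A (A ∷ G) ≡⟨ cong (weight (A ∷ G) * ∣ A ∣ ! *_)
                                                       (#through-∷ k A G) ⟩
  weight (A ∷ G) * ∣ A ∣ ! * #through k A G       ≡⟨ weight*#through-from k A+k G-chain ⟩
  n !                                             ≡⟨ *-identityʳ (n !) ⟨
  n ! * 1                                         ∎
  where open ≡-Reasoning
weight*#through k (suc d) {A} {B} A+k A+d A⊆B G-chain with ⊆⇒≡⊎⊂ A B A⊆B
... | inj₁ refl = contradiction (sym A+d) (m+1+n≢m ∣ A ∣ ∘ sym)
-- Here `A` already has size `n`, which leaves no room for a strictly larger `B`.
weight*#through zero (suc d) {A} {B} A+0 _ _ _ | inj₂ A⊂B =
  contradiction (trans (sym (+-identityʳ ∣ A ∣)) A+0)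
    (<⇒≢ (<-≤-trans (p⊂q⇒∣p∣<∣q∣ A⊂B) (∣p∣≤n B)))
-- Of the covers of `A`, `suc d` lie below `B` and give `n ! * d !` each; the others give 0, since
-- no chain from them meets `B`.
weight*#through {n} (suc k) (suc d) {A} {B} {G} A+k A+d A⊆B G-chain | inj₂ A⊂B = begin
  w * #through (suc k) A (B ∷ G)                  ≡⟨ cong (w *_) (#through-covers k
                                                       (Linked⇒All ⊂-trans A⊂B G-chain)) ⟩
  w * (∑[ A′ ← covers A ] #through k A′ (B ∷ G))  ≡⟨ ∑-*ˡ w _ (covers A) ⟨
  ∑[ A′ ← covers A ] (w * #through k A′ (B ∷ G))  ≡⟨ ∑-covers {A = A} A⊆B A+d through-cover ⟩
  suc d * (n ! * d !)                             ≡⟨ solve 3 (λ i j k → i :* (j :* k) := j :* (i :* k))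
                                                       refl (suc d) (n !) (d !) ⟩
  n ! * suc d !                                   ∎
  where
  open ≡-Reasoning
  w = weight (B ∷ G) * ∣ B ∣ !
  through-cover : ∀ A′ → ∣ A′ ∣ ≡ suc ∣ A ∣ →
                  w * #through k A′ (B ∷ G) ≡ χ (A′ ⊆? B) * (n ! * d !)
  through-cover A′ ∣A′∣ with A′ ⊆? B
  ... | yes A′⊆B = trans
    (weight*#through k d (suc-shift ∣A′∣ A+k) (suc-shift ∣A′∣ A+d) A′⊆B G-chain)
    (sym (*-identityˡ _))
  ... | no  A′⊈B = trans (cong (w *_) (#through-⊈ k G A′⊈B)) (*-zeroʳ w)

-- The climb from `⊥` to the first member `B` has length `∣ B ∣`, so its factor `∣ B ∣ !` appears on
-- both sides and cancels.
weight*#through≡n! : (G : Vec (Subset n) ℓ) → IsChain G → weight G * #through n ⊥ G ≡ n !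
weight*#through≡n! {n} []      _       =
  trans (*-identityˡ _) (#saturated n ⊥ (cong (_+ n) (∣⊥∣≡0 n)))
weight*#through≡n! {n} (B ∷ G) G-chain = *-cancelʳ-≡ _ _ (∣ B ∣ !) {{∣ B ∣ !≢0}} (begin
  weight (B ∷ G) * N * ∣ B ∣ ! ≡⟨ solve 3 (λ i j k → i :* j :* k := i :* k :* j)
                                    refl (weight (B ∷ G)) N (∣ B ∣ !) ⟩
  weight (B ∷ G) * ∣ B ∣ ! * N ≡⟨ weight*#through n ∣ B ∣ (cong (_+ n) (∣⊥∣≡0 n))
                                    (cong (_+ ∣ B ∣) (∣⊥∣≡0 n)) (⊆-min B) G-chain ⟩
  n ! * ∣ B ∣ !                ∎)
  where
  open ≡-Reasoning
  N = #through n ⊥ (B ∷ G)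

-- Averaging the weighted sums over the full chains

ω*#through : (F : Family n) (G : Vec (Subset n) ℓ) → IsChain G →
             ω F G * #through n ⊥ G ≡ n ! * χ (G ⊆ᶠ? F)
-- `ω` and `χ` branch on the same boolean, so one case split settles both.
ω*#through {n} F G G-chain with does (G ⊆ᶠ? F)
... | true  = trans (weight*#through≡n! G G-chain) (sym (*-identityʳ (n !)))
... | false = sym (*-zeroʳ (n !))

#chains≤s : (ℓ : ℕ) (F : Family n) → #chains ℓ F ≤ s ℓ F
#chains≤s {n} ℓ F = *-cancelˡ-≤ (n !) {{n !≢0}} (begin
  n ! * #chains ℓ F
    ≡⟨ cong (n ! *_) (length-filter-χ (_⊆ᶠ? F) 𝒢s) ⟩
  n ! * (∑[ G ← 𝒢s ] χ (G ⊆ᶠ? F))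
    ≡⟨ ∑-*ˡ (n !) _ 𝒢s ⟨
  ∑[ G ← 𝒢s ] (n ! * χ (G ⊆ᶠ? F))
    ≡⟨ ∑-cong-local (ListAll.map (λ {G} → sym ∘ ω*#through F G)
         (ListAll.all-filter isChain? (vecs (subsets n) ℓ))) ⟩
  ∑[ G ← 𝒢s ] (ω F G * #through n ⊥ G)
    ≡⟨ ∑-cong (λ G → ∑-*ˡ (ω F G) _ 𝒞s) 𝒢s ⟨
  ∑[ G ← 𝒢s ] ∑[ 𝒞 ← 𝒞s ] (ω F G * χ (G ⊆ᵛ? 𝒞))
    ≡⟨ ∑-swap _ 𝒢s 𝒞s ⟩
  ∑[ 𝒞 ← 𝒞s ] ∑[ G ← 𝒢s ] (ω F G * χ (G ⊆ᵛ? 𝒞))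
    ≡⟨ ∑-cong (λ 𝒞 → ∑-filter (_⊆ᵛ? 𝒞) (ω F) 𝒢s) 𝒞s ⟨
  ∑ 𝒞s Ω
    -- Each `Ω 𝒞` is an entry of the list whose maximum defines `s ℓ F`.
    ≤⟨ ∑-bound (ListAll.map (ListAll.lookup (ListAll.map⁻ (xs≤max 0 (map Ω (fullChains n)))))
         saturated⊆fullChains) ⟩
  #through n ⊥ [] * s ℓ F
    ≡⟨ cong (_* s ℓ F) (#saturated n ⊥ (cong (_+ n) (∣⊥∣≡0 n))) ⟩
  n ! * s ℓ F ∎)
  where
  open ≤-Reasoning
  𝒢s = chains n ℓ
  𝒞s = saturated n ⊥
  Ω : Vec (Subset n) (suc n) → ℕ
  Ω 𝒞 = ∑ (filter (_⊆ᵛ? 𝒞) 𝒢s) (ω F)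

theorem5p4 : ∀ {d : Level} (n ℓ : ℕ) .{{_ : NonZero n}} .{{_ : NonZero ℓ}}
    (D : Pred (Family n) d) (F : Family n) → D F →
    ∀ (m : ℕ) → IsS ℓ n D m → #chains ℓ F ≤ m
-- As `F` satisfies `D`, the value `s ℓ F` is one of those that `m` bounds.
theorem5p4 n ℓ D F DF m (_ , m-ub) = ≤-trans (#chains≤s ℓ F) (m-ub (s ℓ F) (F , DF , refl))
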